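{- For all integers $r\ge 2$ and $n\ge r$, $$\mathrm{exa}_1(n,K_r)=\binom{r}{2}+(r-2)(n-r)+\mathrm{ex}(n-r,K_r).$$
   Context: For a graph $H$ and a graph $F$, $\mathcal N(H,F)$ denotes the number of subgraphs of $H$ isomorphic to $F$. For a nonnegative integer $k$, $\mathrm{exa}_k(n,F)$ is the largest number of edges of a simple graph $H$ on $n$ vertices with $\mathcal N(H,F)=k$. $\mathrm{ex}(m,F)$ is the Turán number: the largest number of edges of a simple graph on $m$ vertices containing no subgraph isomorphic to $F$ (with $\mathrm{ex}(0,F)=0$). $K_r$ is the complete graph on $r$ vertices. -}

module Defs where

import Algebra.Properties.Semiring.Sum
open import Data.Bool using (Bool; true; false; T; not; _∧_; if_then_else_)
open import Data.Fin using (Fin; _≟_; _<?_)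
open import Data.Fin.Subset using (Subset; _∈_)
open import Data.Nat using (ℕ; _≤_)
open import Data.Nat.Properties using (+-*-semiring)
open import Data.Product using (Σ; ∃; _×_; _,_)
open import Function.Bundles using (Inverse; _⇔_)
open import Function.Definitions using (Injective)
open import Level using (0ℓ)
open import Relation.Binary.Bundles using (Setoid)
open import Relation.Binary.PropositionalEquality
  using (_≡_; refl; sym; trans; cong; setoid)
open import Relation.Nullary using (¬_; does; yes; no; contradiction)

open Algebra.Properties.Semiring.Sum +-*-semiring using (sum)

record Graph (n : ℕ) : Set where
  field
    adj        : Fin n → Fin n → Bool
    adj-sym    : ∀ i j → adj i j ≡ adj j i
    adj-irrefl : ∀ i → adj i i ≡ false

open Graph public

-- Each unordered edge is counted once, at its ordering i < j.
edgeCount : ∀ {n} → Graph n → ℕ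
edgeCount G = sum λ i → sum λ j → if does (i <? j) ∧ adj G i j then 1 else 0

K : ∀ r → Graph r
K r = record
  { adj        = λ i j → not (does (i ≟ j))
  ; adj-sym    = λ i j → cong not (≟-sym i j)
  ; adj-irrefl = λ i → cong not (≟-refl i)
  }
  where
  ≟-sym : ∀ (i j : Fin r) → does (i ≟ j) ≡ does (j ≟ i)
  ≟-sym i j with i ≟ j | j ≟ i
  ... | yes _ | yes _ = refl
  ... | no _  | no _  = refl
  ... | yes p | no q  = contradiction (sym p) q
  ... | no q  | yes p = contradiction (sym p) q

  ≟-refl : ∀ (i : Fin r) → does (i ≟ i) ≡ true
  ≟-refl i with i ≟ i
  ... | yes _ = refl
  ... | no q  = contradiction refl q

-- Subgraphs need be neither induced nor spanning.
record Subgraph {n} (H : Graph n) : Set where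
  field
    V     : Subset n
    E     : Fin n → Fin n → Bool
    E-sym : ∀ i j → E i j ≡ E j i
    E⊆H   : ∀ i j → T (E i j) → T (adj H i j)
    E⊆V   : ∀ i j → T (E i j) → i ∈ V × j ∈ V

open Subgraph public

-- An isomorphism from F onto S: an injection whose image is exactly V S,
-- preserving and reflecting adjacency.
record _≅_ {n m} {H : Graph n} (S : Subgraph H) (F : Graph m) : Set where
  field
    φ           : Fin m → Fin n
    φ-injective : Injective _≡_ _≡_ φ
    φ-image     : ∀ v → v ∈ V S ⇔ ∃ λ i → φ i ≡ v
    φ-adj       : ∀ i j → E S (φ i) (φ j) ≡ adj F i j

-- Two copies are identified when they are the same subgraph, whatever the
-- isomorphisms (and proofs) they carry.
Copies : ∀ {n m} → Graph n → Graph m → Setoid 0ℓ 0ℓ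
Copies H F = record
  { Carrier       = Σ (Subgraph H) (_≅ F)
  ; _≈_           = λ (S , _) (S′ , _) → V S ≡ V S′ × (∀ i j → E S i j ≡ E S′ i j)
  ; isEquivalence = record
    { refl  = refl , λ _ _ → refl
    ; sym   = λ (p , q) → sym p , λ i j → sym (q i j)
    ; trans = λ (p , q) (p′ , q′) → trans p p′ , λ i j → trans (q i j) (q′ i j)
    }
  }

-- 𝒩[ H , F ]≡ k: the set of subgraphs of H isomorphic to F has cardinality k.
𝒩[_,_]≡_ : ∀ {n m} → Graph n → Graph m → ℕ → Set
𝒩[ H , F ]≡ k = Inverse (setoid (Fin k)) (Copies H F)

_Free_ : ∀ {n m} → Graph m → Graph n → Set
F Free H = ¬ (∃ λ (S : Subgraph H) → S ≅ F)

IsLargest : (ℕ → Set) → ℕ → Set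
IsLargest P m = P m × (∀ k → P k → k ≤ m)

-- Extremal numbers are given as relations "the extremal number
-- exists and equals e": exa is undefined when no graph has exactly k copies.
-- No clause is needed for ex(0,F) = 0 when F has a vertex: the graph on Fin 0
-- is then F-free and has no edges.
exa[_,_,_]≡_ : ∀ {m} → ℕ → ℕ → Graph m → ℕ → Set
exa[ k , n , F ]≡ e =
  IsLargest (λ x → ∃ λ (H : Graph n) → (𝒩[ H , F ]≡ k) × edgeCount H ≡ x) e

ex[_,_]≡_ : ∀ {m} → ℕ → Graph m → ℕ → Set
ex[ n , F ]≡ e =
  IsLargest (λ x → ∃ λ (H : Graph n) → F Free H × edgeCount H ≡ x) e

{-# OPTIONS --safe #-}
module Submission where

-- Upper bound: let A be the vertex set of the unique K_r. A vertex outside A has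
-- at most r − 2 neighbours in A, since r − 1 of them would give a second K_r, and
-- the graph outside A is K_r-free.
--
-- Lower bound: some extremal K_r-free graph on n − r vertices is (r−1)-partite
-- (Turán). Add a K_r on vertices 0, …, r − 1 and join each vertex of the b-th
-- colour class (0 ≤ b < r − 1) to all of these except 0 and b + 1. A second K_r
-- would have to avoid 0, but without 0 the graph is (r−1)-colourable.
--
-- Turán's theorem is proved by induction on the number of colours: the
-- neighbourhood of a vertex of maximum degree is recoloured by induction, and
-- all other vertices become a new colour class joined to it completely.

open import Data.Nat using (ℕ; _+_; _*_; _∸_; _≤_)
open import Data.Nat.Combinatorics using (_C_)
open import Data.Product using (∃; _×_)
open import Relation.Binary.PropositionalEquality using (_≡_)
open import Defs

import Algebra.Properties.Semiring.Sum
open import Data.Bool using (Bool; true; false; T; not; _∧_; if_then_else_)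
open import Data.Bool.Properties using (T-≡; ⇔→≡; ∧-comm)
open import Data.Fin using (Fin; zero; suc; toℕ; fromℕ<; _≟_; _<?_; _↑ˡ_; splitAt; punchOut)
open import Data.Fin.Properties
  using (any?; pigeonhole; suc-injective; punchOut-injective; <-cmp; <⇒≢; <⇒notInjective;
         toℕ≤pred[n]; toℕ-fromℕ<; splitAt-↑ˡ; splitAt⁻¹-↑ˡ)
open import Data.Fin.Subset using (_∈_)
open import Data.Fin.Subset.Properties using (⊆-antisym)
open import Data.Nat using (zero; suc; z≤n; s≤s; _≤?_)
open import Data.Nat.Combinatorics using (nC1≡n; nCk+nC[k+1]≡[n+1]C[k+1])
open import Data.Nat.Properties hiding (_≟_; _<?_; <-cmp; <⇒≢; suc-injective)
open import Data.Nat.Tactic.RingSolver using (solve-∀)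
open import Data.Product using (_,_; proj₁; proj₂; Σ-syntax)
open import Data.Sum as Sum using (_⊎_; inj₁; inj₂)
open import Data.Vec using (tabulate)
open import Data.Vec.Properties using (lookup∘tabulate; []=⇒lookup; lookup⇒[]=)
open import Function using (_∘_; id; const; _⇔_; mk⇔; Equivalence; Inverse)
open import Function.Definitions using (Injective)
open import Relation.Binary using (Setoid; tri<; tri≈; tri>)
open import Relation.Binary.PropositionalEquality
  using (refl; sym; trans; cong; cong₂; subst; _≢_; module ≡-Reasoning)
open import Relation.Nullary using (¬_; does; yes; no; contradiction)
open import Relation.Nullary.Decidable using (dec-true; dec-false)

open Algebra.Properties.Semiring.Sum +-*-semiring
  using (sum; sum-cong-≗; ∑-comm; ∑-distrib-+; *-distribˡ-sum)

private
  variable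
    k l m n r s t : ℕ

-- Sums and maxima over finite index sets

ind : Bool → ℕ
ind b = if b then 1 else 0

ind-∧ : ∀ a b → ind (a ∧ b) ≡ ind a * ind b
ind-∧ true  b = sym (+-identityʳ (ind b))
ind-∧ false b = refl

sum-mono-≤ : {f g : Fin n → ℕ} → (∀ i → f i ≤ g i) → sum f ≤ sum g
sum-mono-≤ {zero}  f≤g = z≤n
sum-mono-≤ {suc n} f≤g = +-mono-≤ (f≤g zero) (sum-mono-≤ (f≤g ∘ suc))

sum-const : ∀ n c → sum {n} (λ _ → c) ≡ n * c
sum-const zero    c = refl
sum-const (suc n) c = cong (c +_) (sum-const n c)

sum-*ʳ : ∀ (f : Fin n → ℕ) c → sum (λ i → f i * c) ≡ sum f * c
sum-*ʳ {zero}  f c = refl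
sum-*ʳ {suc n} f c =
  trans (cong (f zero * c +_) (sum-*ʳ (f ∘ suc) c)) (sym (*-distribʳ-+ c (f zero) _))

sum-splitAt : ∀ k (f : Fin k ⊎ Fin l → ℕ) →
              sum (f ∘ splitAt k) ≡ sum (f ∘ inj₁) + sum (f ∘ inj₂)
sum-splitAt zero    f = refl
sum-splitAt (suc k) f =
  trans (cong (f (inj₁ zero) +_) (sum-splitAt k (f ∘ Sum.map suc id)))
        (sym (+-assoc (f (inj₁ zero)) _ _))

sum-≢ : ∀ (i : Fin (suc n)) → sum (λ j → ind (not (does (i ≟ j)))) ≡ n
sum-≢ {n} zero    = trans (sum-const n 1) (*-identityʳ n)
sum-≢ {suc n} (suc i) = cong suc (sum-≢ i)

sum-δ : ∀ (i : Fin n) (f : Fin n → ℕ) → sum (λ j → ind (does (i ≟ j)) * f j) ≡ f i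
sum-δ {suc n} zero    f = trans (cong₂ _+_ (*-identityˡ (f zero)) (trans (sum-const n 0) (*-zeroʳ n)))
                                (+-identityʳ (f zero))
sum-δ {suc n} (suc i) f = sum-δ i (f ∘ suc)

-- Serves twice in Turán's theorem: to find a vertex of maximum degree within `W`, and to find the
-- best size for the old part of a join.
argmax : (f : Fin n → ℕ) (W : Fin n → Bool) →
         (∀ i → W i ≡ false) ⊎
         (Σ[ v ∈ Fin n ] (W v ≡ true × (∀ i → W i ≡ true → f i ≤ f v)))
argmax {zero}  f W = inj₁ λ ()
argmax {suc n} f W with argmax (f ∘ suc) (W ∘ suc) | W zero in W₀
... | inj₁ none | false = inj₁ λ { zero → W₀ ; (suc i) → none i }
... | inj₁ none | true  = inj₂ (zero , W₀ , λ
  { zero _ → ≤-refl ; (suc i) Wi → contradiction (trans (sym Wi) (none i)) λ () })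
... | inj₂ (v , Wv , v-max) | false = inj₂ (suc v , Wv , λ
  { zero Wi → contradiction (trans (sym Wi) W₀) λ () ; (suc i) Wi → v-max i Wi })
... | inj₂ (v , Wv , v-max) | true with f zero ≤? f (suc v)
...   | yes f₀≤fᵥ = inj₂ (suc v , Wv , λ { zero _ → f₀≤fᵥ ; (suc i) Wi → v-max i Wi })
...   | no  f₀≰fᵥ = inj₂ (zero , W₀ , λ
  { zero _ → ≤-refl ; (suc i) Wi → ≤-trans (v-max i Wi) (<⇒≤ (≰⇒> f₀≰fᵥ)) })

-- Applied to the adjacencies between an outside vertex and a clique: the first case permits an
-- exchange, the second saves two neighbours.
all-but-one⊎deficient : (f : Fin (suc n) → Bool) →
  (Σ[ b ∈ Fin (suc n) ] (∀ i → i ≢ b → f i ≡ true)) ⊎ suc (sum (ind ∘ f)) ≤ n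
all-but-one⊎deficient {zero} f = inj₁ (zero , λ { zero i≢b → contradiction refl i≢b })
all-but-one⊎deficient {suc n} f with f zero in f₀ | all-but-one⊎deficient (f ∘ suc)
... | true  | inj₁ (b , all) = inj₁ (suc b , λ
  { zero _ → f₀ ; (suc i) i≢b → all i (i≢b ∘ cong suc) })
... | true  | inj₂ few       = inj₂ (s≤s few)
... | false | inj₂ few       = inj₂ (m≤n⇒m≤1+n few)
... | false | inj₁ (b , all) with f (suc b) in f_b
-- The exception in the tail is spurious, so `zero` is the only false index.
...   | true  = inj₁ (zero , λ
  { zero i≢b → contradiction refl i≢b
  ; (suc i) _ → full i })
  where
  full : ∀ i → f (suc i) ≡ true
  full i with i ≟ b
  ... | yes refl = f_b
  ... | no  i≢b  = all i i≢b
-- Both `zero` and `suc b` are false, leaving at most n true values among n + 2.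
...   | false = inj₂ (s≤s (≤-trans (sum-mono-≤ bound) (≤-reflexive (sum-≢ b))))
  where
  bound : ∀ i → ind (f (suc i)) ≤ ind (not (does (b ≟ i)))
  bound i with b ≟ i
  ... | yes refl = ≤-reflexive (cong ind f_b)
  ... | no _ with f (suc i)
  ...   | true  = ≤-refl
  ...   | false = z≤n

-- Counting edges inside and between vertex sets

size : (Fin n → Bool) → ℕ
size W = sum (ind ∘ W)

module _ (G : Graph n) where

  deg : (Fin n → Bool) → Fin n → ℕ
  deg W i = sum λ j → ind (W j) * ind (adj G i j)

  -- Ordered pairs are counted, so an edge inside `W` contributes 2 to `pairs W W`. This avoids
  -- comparing indices and explains the factors 2 below.
  pairs : (Fin n → Bool) → (Fin n → Bool) → ℕ
  pairs W U = sum λ i → ind (W i) * deg U i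

  pairs-comm : ∀ W U → pairs W U ≡ pairs U W
  pairs-comm W U = begin
    (sum λ i → ind (W i) * deg U i)
      ≡⟨ sum-cong-≗ (λ i → *-distribˡ-sum (ind (W i)) (λ j → ind (U j) * ind (adj G i j))) ⟩
    (sum λ i → sum λ j → ind (W i) * (ind (U j) * ind (adj G i j)))
      ≡⟨ ∑-comm (λ i j → ind (W i) * (ind (U j) * ind (adj G i j))) ⟩
    (sum λ j → sum λ i → ind (W i) * (ind (U j) * ind (adj G i j)))
      ≡⟨ sum-cong-≗ (λ j → sum-cong-≗ λ i → trans
           (cong (λ b → ind (W i) * (ind (U j) * ind b)) (adj-sym G i j))
           (x*[y*z]≡y*[x*z] (ind (W i)) (ind (U j)) _)) ⟩
    (sum λ j → sum λ i → ind (U j) * (ind (W i) * ind (adj G j i)))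
      ≡⟨ sum-cong-≗ (λ j → *-distribˡ-sum (ind (U j)) (λ i → ind (W i) * ind (adj G j i))) ⟨
    (sum λ j → ind (U j) * deg W j) ∎
    where
    open ≡-Reasoning
    x*[y*z]≡y*[x*z] : ∀ x y z → x * (y * z) ≡ y * (x * z)
    x*[y*z]≡y*[x*z] = solve-∀

  pairs≤size*d : ∀ W U d → (∀ i → W i ≡ true → deg U i ≤ d) → pairs W U ≤ size W * d
  pairs≤size*d W U d deg≤d = ≤-trans (sum-mono-≤ pointwise) (≤-reflexive (sum-*ʳ (ind ∘ W) d))
    where
    pointwise : ∀ i → ind (W i) * deg U i ≤ ind (W i) * d
    pointwise i with W i in Wi
    ... | true  = +-monoˡ-≤ 0 (deg≤d i Wi)
    ... | false = z≤n

module _ {W : Fin n → Bool} (P Q : Fin n → Bool) (W≡P+Q : ∀ i → ind (W i) ≡ ind (P i) + ind (Q i)) where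

  -- The equation between indicators encodes that `W` is the disjoint union of `P` and `Q`.
  size-⊎ : size W ≡ size P + size Q
  size-⊎ = trans (sum-cong-≗ W≡P+Q) (∑-distrib-+ (ind ∘ P) (ind ∘ Q))

  module _ (G : Graph n) where

    pairs-⊎ˡ : ∀ U → pairs G W U ≡ pairs G P U + pairs G Q U
    pairs-⊎ˡ U = trans
      (sum-cong-≗ λ i → trans (cong (_* deg G U i) (W≡P+Q i)) (*-distribʳ-+ (deg G U i) (ind (P i)) _))
      (∑-distrib-+ (λ i → ind (P i) * deg G U i) _)

    pairs-⊎ʳ : ∀ U → pairs G U W ≡ pairs G U P + pairs G U Q
    pairs-⊎ʳ U = trans (pairs-comm G U W)
      (trans (pairs-⊎ˡ U) (cong₂ _+_ (pairs-comm G P U) (pairs-comm G Q U)))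

    pairs-⊎ : pairs G W W ≡ pairs G P P + (2 * pairs G Q P + pairs G Q Q)
    pairs-⊎ = begin
      pairs G W W
        ≡⟨ pairs-⊎ˡ W ⟩
      pairs G P W + pairs G Q W
        ≡⟨ cong₂ _+_ (pairs-⊎ʳ P) (pairs-⊎ʳ Q) ⟩
      (pairs G P P + pairs G P Q) + (pairs G Q P + pairs G Q Q)
        ≡⟨ cong (λ x → (pairs G P P + x) + (pairs G Q P + pairs G Q Q)) (pairs-comm G P Q) ⟩
      (pairs G P P + pairs G Q P) + (pairs G Q P + pairs G Q Q)
        ≡⟨ regroup (pairs G P P) (pairs G Q P) (pairs G Q Q) ⟩
      pairs G P P + (2 * pairs G Q P + pairs G Q Q) ∎
      where
      open ≡-Reasoning
      regroup : ∀ x y z → (x + y) + (y + z) ≡ x + (2 * y + z)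
      regroup = solve-∀

-- The handshake identity and the edges of complete graphs

full : Fin n → Bool
full = const true

size-full : size (full {n}) ≡ n
size-full {n} = trans (sum-const n 1) (*-identityʳ n)

-- By trichotomy, an adjacent pair is counted by `edgeCount` in exactly one of its two orders.
∑adj≡2*edgeCount : (G : Graph n) → (sum λ i → sum λ j → ind (adj G i j)) ≡ 2 * edgeCount G
∑adj≡2*edgeCount G = begin
  (sum λ i → sum λ j → ind (adj G i j))
    ≡⟨ sum-cong-≗ (λ i → trans (sum-cong-≗ (orient i)) (∑-distrib-+ (λ j → up i j) (λ j → up j i))) ⟩
  (sum λ i → (sum λ j → up i j) + (sum λ j → up j i))
    ≡⟨ ∑-distrib-+ (λ i → sum λ j → up i j) _ ⟩
  edgeCount G + (sum λ i → sum λ j → up j i)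
    ≡⟨ cong (edgeCount G +_) (trans (∑-comm (λ i j → up j i)) (sym (+-identityʳ _))) ⟩
  2 * edgeCount G ∎
  where
  open ≡-Reasoning
  up : ∀ i j → ℕ
  up i j = ind (does (i <? j) ∧ adj G i j)

  orient : ∀ i j → ind (adj G i j) ≡ up i j + up j i
  orient i j with <-cmp i j
  ... | tri< i<j _ j≮i rewrite dec-true (i <? j) i<j | dec-false (j <? i) j≮i = sym (+-identityʳ _)
  ... | tri≈ i≮j refl _ rewrite dec-false (i <? i) i≮j | adj-irrefl G i = refl
  ... | tri> i≮j _ j<i rewrite dec-false (i <? j) i≮j | dec-true (j <? i) j<i = cong ind (adj-sym G i j)

pairs-full : (G : Graph n) → pairs G full full ≡ 2 * edgeCount G
pairs-full G = trans
  (sum-cong-≗ λ i → trans (*-identityˡ (deg G full i)) (sum-cong-≗ λ j → *-identityˡ (ind (adj G i j))))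
  (∑adj≡2*edgeCount G)

K-adj : {i j : Fin r} → i ≢ j → adj (K r) i j ≡ true
K-adj {i = i} {j} i≢j = cong not (dec-false (i ≟ j) i≢j)

∑adj-K : ∀ r → (sum λ i → sum λ j → ind (adj (K (suc r)) i j)) ≡ suc r * r
∑adj-K r = trans (sum-cong-≗ (sum-≢ {r})) (sum-const (suc r) r)

2*[1+r]C2 : ∀ r → 2 * (suc r C 2) ≡ suc r * r
2*[1+r]C2 zero    = refl
2*[1+r]C2 (suc r) = begin
  2 * (suc (suc r) C 2)             ≡⟨ cong (2 *_) (nCk+nC[k+1]≡[n+1]C[k+1] (suc r) 1) ⟨
  2 * (suc r C 1 + suc r C 2)       ≡⟨ cong (λ x → 2 * (x + suc r C 2)) (nC1≡n (suc r)) ⟩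
  2 * (suc r + suc r C 2)           ≡⟨ *-distribˡ-+ 2 (suc r) _ ⟩
  2 * suc r + 2 * (suc r C 2)       ≡⟨ cong (2 * suc r +_) (2*[1+r]C2 r) ⟩
  2 * suc r + suc r * r             ≡⟨ regroup r ⟩
  suc (suc r) * suc r               ∎
  where
  open ≡-Reasoning
  regroup : ∀ r → 2 * suc r + suc r * r ≡ suc (suc r) * suc r
  regroup = solve-∀

edgeCount-K : ∀ r → edgeCount (K (suc r)) ≡ suc r C 2
edgeCount-K r = *-cancelˡ-≡ _ _ 2
  (trans (sym (∑adj≡2*edgeCount (K (suc r)))) (trans (∑adj-K r) (sym (2*[1+r]C2 r))))

-- Joining two graphs by a prescribed bipartite graph

module _ (G : Graph k) (H : Graph l) (link : Fin k → Fin l → Bool) where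

  glueAdj : Fin k ⊎ Fin l → Fin k ⊎ Fin l → Bool
  glueAdj (inj₁ a) (inj₁ b) = adj G a b
  glueAdj (inj₁ a) (inj₂ w) = link a w
  glueAdj (inj₂ v) (inj₁ b) = link b v
  glueAdj (inj₂ v) (inj₂ w) = adj H v w

  glue : Graph (k + l)
  glue = record
    { adj        = λ i j → glueAdj (splitAt k i) (splitAt k j)
    ; adj-sym    = λ i j → glue-sym (splitAt k i) (splitAt k j)
    ; adj-irrefl = λ i → glue-irrefl (splitAt k i)
    }
    where
    glue-sym : ∀ x y → glueAdj x y ≡ glueAdj y x
    glue-sym (inj₁ a) (inj₁ b) = adj-sym G a b
    glue-sym (inj₁ a) (inj₂ w) = refl
    glue-sym (inj₂ v) (inj₁ b) = refl
    glue-sym (inj₂ v) (inj₂ w) = adj-sym H v w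

    glue-irrefl : ∀ x → glueAdj x x ≡ false
    glue-irrefl (inj₁ a) = adj-irrefl G a
    glue-irrefl (inj₂ v) = adj-irrefl H v

  -- After doubling, the adjacency matrix splits into four blocks, and the two mixed blocks are
  -- transposes of each other.
  edgeCount-glue : edgeCount glue ≡ edgeCount G + (sum λ v → sum λ a → ind (link a v)) + edgeCount H
  edgeCount-glue = *-cancelˡ-≡ _ _ 2 (begin
    2 * edgeCount glue
      ≡⟨ ∑adj≡2*edgeCount glue ⟨
    (sum λ i → sum λ j → ind (glueAdj (splitAt k i) (splitAt k j)))
      ≡⟨ sum-cong-≗ (λ i → sum-splitAt k (λ y → ind (glueAdj (splitAt k i) y))) ⟩
    (sum λ i → toG (splitAt k i) + toH (splitAt k i))
      ≡⟨ sum-splitAt k (λ x → toG x + toH x) ⟩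
    (sum λ a → toG (inj₁ a) + toH (inj₁ a)) + (sum λ v → toG (inj₂ v) + toH (inj₂ v))
      ≡⟨ cong₂ _+_ (∑-distrib-+ (toG ∘ inj₁) (toH ∘ inj₁)) (∑-distrib-+ (toG ∘ inj₂) (toH ∘ inj₂)) ⟩
    (sum (toG ∘ inj₁) + sum (toH ∘ inj₁)) + (cross + sum (toH ∘ inj₂))
      ≡⟨ cong₂ (λ x y → (x + y) + (cross + sum (toH ∘ inj₂)))
           (∑adj≡2*edgeCount G) (∑-comm (λ a v → ind (link a v))) ⟩
    (2 * edgeCount G + cross) + (cross + sum (toH ∘ inj₂))
      ≡⟨ cong (λ x → (2 * edgeCount G + cross) + (cross + x)) (∑adj≡2*edgeCount H) ⟩
    (2 * edgeCount G + cross) + (cross + 2 * edgeCount H)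
      ≡⟨ regroup (edgeCount G) cross (edgeCount H) ⟩
    2 * (edgeCount G + cross + edgeCount H) ∎)
    where
    open ≡-Reasoning
    toG toH : Fin k ⊎ Fin l → ℕ
    toG x = sum λ b → ind (glueAdj x (inj₁ b))
    toH x = sum λ w → ind (glueAdj x (inj₂ w))
    cross : ℕ
    cross = sum λ v → sum λ a → ind (link a v)
    regroup : ∀ x y z → (2 * x + y) + (y + 2 * z) ≡ 2 * (x + y + z)
    regroup = solve-∀

edgeless : ∀ n → Graph n
edgeless n = record
  { adj        = λ _ _ → false
  ; adj-sym    = λ _ _ → refl
  ; adj-irrefl = λ _ → refl
  }

edgeCount-edgeless : ∀ n → edgeCount (edgeless n) ≡ 0
edgeCount-edgeless n = *-cancelˡ-≡ _ 0 2
  (trans (sym (∑adj≡2*edgeCount (edgeless n)))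
         (trans (sum-cong-≗ {n} (λ _ → sum-const n 0)) (trans (sum-const n (n * 0)) (zeros n))))
  where
  zeros : ∀ n → n * (n * 0) ≡ 0
  zeros = solve-∀

-- Turán's theorem

record Clique (G : Graph n) (W : Fin n → Bool) (r : ℕ) : Set where
  field
    vertex   : Fin r → Fin n
    inside   : ∀ i → W (vertex i) ≡ true
    adjacent : ∀ {i j} → i ≢ j → adj G (vertex i) (vertex j) ≡ true

  -- A repeated vertex would be adjacent to itself.
  vertex-injective : Injective _≡_ _≡_ vertex
  vertex-injective {i} {j} vᵢ≡vⱼ with i ≟ j
  ... | yes i≡j = i≡j
  ... | no  i≢j = contradiction
    (trans (sym (adjacent i≢j)) (trans (cong (adj G (vertex i)) (sym vᵢ≡vⱼ)) (adj-irrefl G _))) λ ()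

open Clique

∧-true : ∀ {a b} → a ∧ b ≡ true → a ≡ true × b ≡ true
∧-true {true} {true} _ = refl , refl

-- Contrapositively, forbidding a clique in `W` forbids one with a vertex fewer in each
-- neighbourhood; this drives Turán's induction.
cons : {G : Graph n} {W : Fin n → Bool} {v : Fin n} → W v ≡ true →
       Clique G (λ i → W i ∧ adj G v i) r → Clique G W (suc r)
cons {G = G} {v = v} Wv Q = record
  { vertex   = vertex′
  ; inside   = λ { zero → Wv ; (suc i) → proj₁ (∧-true (inside Q i)) }
  ; adjacent = λ {i} {j} → adjacent′ i j
  }
  where
  vertex′ : Fin _ → Fin _
  vertex′ zero    = v
  vertex′ (suc i) = vertex Q i

  adjacent′ : ∀ i j → i ≢ j → adj G (vertex′ i) (vertex′ j) ≡ true
  adjacent′ zero    zero    i≢j = contradiction refl i≢j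
  adjacent′ zero    (suc j) _   = proj₂ (∧-true (inside Q j))
  adjacent′ (suc i) zero    _   = trans (adj-sym G _ _) (proj₂ (∧-true (inside Q i)))
  adjacent′ (suc i) (suc j) i≢j = adjacent Q (i≢j ∘ cong suc)

emptyClique : {G : Graph n} {W : Fin n → Bool} → Clique G W 0
emptyClique = record { vertex = λ () ; inside = λ () ; adjacent = λ { {()} } }

-- The index is shifted so that `suc s` colours match the forbidden clique on `2 + s` vertices, that
-- is, r = s + 2.
record Partite (s m t : ℕ) : Set where
  field
    graph    : Graph m
    colour   : Fin m → Fin (suc s)
    proper   : ∀ i j → adj graph i j ≡ true → colour i ≢ colour j
    attained : edgeCount graph ≡ t

open Partite

-- Stated for vertex sets, so that it applies both to the neighbourhood in the
-- induction and to the complement of the unique clique.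
CliqueFreeBound : ℕ → ℕ → ℕ → Set
CliqueFreeBound s m t = ∀ {n} (G : Graph n) W → size W ≡ m →
  ¬ Clique G W (2 + s) → pairs G W W ≤ 2 * t

-- The Turán number, kept abstract: no closed formula for t is needed.
Turán : ℕ → ℕ → Set
Turán s m = ∃ λ t → Partite s m t × CliqueFreeBound s m t

turán-zero : ∀ m → Turán 0 m
turán-zero m = 0 , partite , bound
  where
  partite : Partite 0 m 0
  partite = record
    { graph    = edgeless m
    ; colour   = const zero
    ; proper   = λ _ _ ()
    ; attained = edgeCount-edgeless m
    }

  bound : CliqueFreeBound 0 m 0
  bound {n} G W _ noEdge = ≤-trans
    (pairs≤size*d G W W 0 λ i Wi →
      ≤-reflexive (trans (sum-cong-≗ (isolated i Wi)) (trans (sum-const n 0) (*-zeroʳ n))))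
    (≤-reflexive (*-zeroʳ (size W)))
    where
    isolated : ∀ i → W i ≡ true → ∀ j → ind (W j) * ind (adj G i j) ≡ 0
    isolated i Wi j with W j in Wj | adj G i j in ij
    ... | false | _     = refl
    ... | true  | false = refl
    ... | true  | true  = contradiction
      (cons Wi (cons {v = j} (cong₂ _∧_ Wj ij) emptyClique)) noEdge

addColourClass : Partite s k t → ∀ l → Partite (suc s) (k + l) (t + k * l)
addColourClass {s} {k} {t} P l = record
  { graph    = joined
  ; colour   = colour′ ∘ splitAt k
  ; proper   = λ i j → proper′ (splitAt k i) (splitAt k j)
  ; attained = begin
      edgeCount joined
        ≡⟨ edgeCount-glue (graph P) (edgeless l) (λ _ _ → true) ⟩
      edgeCount (graph P) + (sum {l} λ _ → sum {k} λ _ → 1) + edgeCount (edgeless l)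
        ≡⟨ cong₂ _+_ (cong₂ _+_ (attained P) cross≡l*k) (edgeCount-edgeless l) ⟩
      t + l * k + 0
        ≡⟨ +-identityʳ _ ⟩
      t + l * k
        ≡⟨ cong (t +_) (*-comm l k) ⟩
      t + k * l ∎
  }
  where
  open ≡-Reasoning
  joined : Graph (k + l)
  joined = glue (graph P) (edgeless l) (λ _ _ → true)

  cross≡l*k : (sum {l} λ _ → sum {k} λ _ → 1) ≡ l * k
  cross≡l*k = trans (sum-const l _) (cong (l *_) (trans (sum-const k 1) (*-identityʳ k)))

  colour′ : Fin k ⊎ Fin l → Fin (suc (suc s))
  colour′ (inj₁ a) = suc (colour P a)
  colour′ (inj₂ v) = zero

  proper′ : ∀ x y → glueAdj (graph P) (edgeless l) (λ _ _ → true) x y ≡ true → colour′ x ≢ colour′ y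
  proper′ (inj₁ a) (inj₁ b) ab = proper P a b ab ∘ suc-injective
  proper′ (inj₁ a) (inj₂ w) _  = λ ()
  proper′ (inj₂ v) (inj₁ b) _  = λ ()
  proper′ (inj₂ v) (inj₂ w) ()

-- Let v have maximum degree d in `W`. Its neighbourhood `N` has at most `τ d` edges, and every
-- other edge has an end in the rest `R`, whose m - d vertices have degree at most d.
cliqueFreeBound-suc : (τ : ℕ → ℕ) → (∀ d → CliqueFreeBound s d (τ d)) →
  ∀ {m t} → (∀ d → d ≤ m → τ d + d * (m ∸ d) ≤ t) → CliqueFreeBound (suc s) m t
cliqueFreeBound-suc τ τ-bound {m} {t} t-max {n} G W |W|≡m noClique with argmax (deg G W) W
... | inj₁ empty = ≤-trans
  (pairs≤size*d G W W 0 λ i Wi → contradiction (trans (sym Wi) (empty i)) λ ())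
  (≤-trans (≤-reflexive (*-zeroʳ (size W))) z≤n)
... | inj₂ (v , Wv , v-max) = begin
  pairs G W W
    ≡⟨ pairs-⊎ N R W≡N+R G ⟩
  pairs G N N + (2 * pairs G R N + pairs G R R)
    -- Counting the pairs inside `R` once more turns the last two terms into twice the degree sum of
    -- `R`.
    ≤⟨ +-monoʳ-≤ (pairs G N N) (≤-trans
         (m≤m+n _ (pairs G R R)) (≤-reflexive (regroup (pairs G R N) (pairs G R R)))) ⟩
  pairs G N N + 2 * (pairs G R N + pairs G R R)
    ≡⟨ cong (λ x → pairs G N N + 2 * x) (pairs-⊎ʳ N R W≡N+R G R) ⟨
  pairs G N N + 2 * pairs G R W
    ≤⟨ +-mono-≤ (τ-bound d G N refl (noClique ∘ cons Wv))
                (*-monoʳ-≤ 2 (pairs≤size*d G R W d R-deg)) ⟩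
  2 * τ d + 2 * (size R * d)
    ≡⟨ *-distribˡ-+ 2 (τ d) _ ⟨
  2 * (τ d + size R * d)
    ≡⟨ cong (λ x → 2 * (τ d + x)) (trans (*-comm (size R) d) (cong (d *_) |R|≡m∸d)) ⟩
  2 * (τ d + d * (m ∸ d))
    ≤⟨ *-monoʳ-≤ 2 (t-max d d≤m) ⟩
  2 * t ∎
  where
  open ≤-Reasoning
  N R : Fin n → Bool
  N i = W i ∧ adj G v i
  R i = W i ∧ not (adj G v i)

  d : ℕ
  d = size N

  W≡N+R : ∀ i → ind (W i) ≡ ind (N i) + ind (R i)
  W≡N+R i with W i | adj G v i
  ... | false | _     = refl
  ... | true  | false = refl
  ... | true  | true  = refl

  m≡d+|R| : m ≡ d + size R
  m≡d+|R| = trans (sym |W|≡m) (size-⊎ N R W≡N+R)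

  d≤m : d ≤ m
  d≤m = ≤-trans (m≤m+n d (size R)) (≤-reflexive (sym m≡d+|R|))

  |R|≡m∸d : size R ≡ m ∸ d
  |R|≡m∸d = sym (trans (cong (_∸ d) m≡d+|R|) (m+n∸m≡n d (size R)))

  R-deg : ∀ i → R i ≡ true → deg G W i ≤ d
  R-deg i Ri = ≤-trans (v-max i (proj₁ (∧-true Ri)))
    (≤-reflexive (sum-cong-≗ λ j → sym (ind-∧ (W j) (adj G v j))))

  regroup : ∀ x y → 2 * x + y + y ≡ 2 * (x + y)
  regroup = solve-∀

turán : ∀ s m → Turán s m
turán zero    m = turán-zero m
-- The candidates join an extremal graph on k vertices to m - k independent ones, for 0 ≤ k ≤ m. The
-- maximiser supplies the graph, and maximality the bound.
turán (suc s) m with argmax {suc m} (λ k → proj₁ (turán s (toℕ k)) + toℕ k * (m ∸ toℕ k)) full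
... | inj₁ none = contradiction (none zero) λ ()
... | inj₂ (k , _ , k-max) =
  τ d + d * (m ∸ d)
  , subst (λ m′ → Partite (suc s) m′ (τ d + d * (m ∸ d))) (m+[n∸m]≡n (toℕ≤pred[n] k))
      (addColourClass (proj₁ (proj₂ (turán s d))) (m ∸ d))
  , cliqueFreeBound-suc τ (λ d → proj₂ (proj₂ (turán s d))) max
  where
  τ : ℕ → ℕ
  τ d = proj₁ (turán s d)

  d : ℕ
  d = toℕ k

  max : ∀ c → c ≤ m → τ c + c * (m ∸ c) ≤ τ d + d * (m ∸ d)
  max c c≤m = subst (λ x → τ x + x * (m ∸ x) ≤ τ d + d * (m ∸ d))
    (toℕ-fromℕ< (s≤s c≤m)) (k-max (fromℕ< (s≤s c≤m)) refl)

-- Copies of complete graphs as cliques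

module _ (φ : Fin r → Fin n) where

  inImage : Fin n → Bool
  inImage v = does (any? λ i → φ i ≟ v)

  inImage⇔ : ∀ v → inImage v ≡ true ⇔ ∃ λ i → φ i ≡ v
  inImage⇔ v with any? (λ i → φ i ≟ v)
  ... | yes v∈φ = mk⇔ (const v∈φ) (const refl)
  ... | no  v∉φ = mk⇔ (λ ()) (λ v∈φ → contradiction v∈φ v∉φ)

  ∈-image : ∀ i → inImage (φ i) ≡ true
  ∈-image i = Equivalence.from (inImage⇔ (φ i)) (i , refl)

  module _ (φ-injective : Injective _≡_ _≡_ φ) where

    -- By injectivity, at most one term of the sum is nonzero.
    ind-inImage : ∀ v → ind (inImage v) ≡ sum λ i → ind (does (φ i ≟ v))
    ind-inImage v with any? (λ i → φ i ≟ v)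
    ... | yes (i , refl) = sym (trans
      (sum-cong-≗ λ j → trans (cong ind (φ-reflects i j)) (sym (*-identityʳ (ind (does (i ≟ j))))))
      (sum-δ i (const 1)))
      where
      φ-reflects : ∀ i j → does (φ j ≟ φ i) ≡ does (i ≟ j)
      φ-reflects i j with i ≟ j
      ... | yes refl = dec-true (φ i ≟ φ i) refl
      ... | no  i≢j  = dec-false (φ j ≟ φ i) (i≢j ∘ sym ∘ φ-injective)
    ... | no v∉φ = sym (trans
      (sum-cong-≗ λ j → cong ind (dec-false (φ j ≟ v) λ φj≡v → v∉φ (j , φj≡v)))
      (trans (sum-const r 0) (*-zeroʳ r)))

    sum-image : ∀ (f : Fin n → ℕ) → (sum λ v → ind (inImage v) * f v) ≡ sum (f ∘ φ)
    sum-image f = begin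
      (sum λ v → ind (inImage v) * f v)
        ≡⟨ sum-cong-≗ (λ v → cong (_* f v) (ind-inImage v)) ⟩
      (sum λ v → (sum λ i → ind (does (φ i ≟ v))) * f v)
        ≡⟨ sum-cong-≗ (λ v → sum-*ʳ (λ i → ind (does (φ i ≟ v))) (f v)) ⟨
      (sum λ v → sum λ i → ind (does (φ i ≟ v)) * f v)
        ≡⟨ ∑-comm (λ v i → ind (does (φ i ≟ v)) * f v) ⟩
      (sum λ i → sum λ v → ind (does (φ i ≟ v)) * f v)
        ≡⟨ sum-cong-≗ (λ i → sum-δ (φ i) f) ⟩
      sum (f ∘ φ) ∎
      where open ≡-Reasoning

    size-image : size inImage ≡ r
    size-image = trans
      (sum-cong-≗ λ v → sym (*-identityʳ (ind (inImage v))))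
      (trans (sum-image (const 1)) (trans (sum-const r 1) (*-identityʳ r)))

-- Punching out a missed value would inject a finite set into a smaller one.
injective⇒surjective : {φ : Fin n → Fin n} → Injective _≡_ _≡_ φ → ∀ v → ∃ λ i → φ i ≡ v
injective⇒surjective {suc n} {φ} φ-injective v with any? (λ i → φ i ≟ v)
... | yes v∈φ = v∈φ
... | no  v∉φ = contradiction
  (λ {i} {j} eq → φ-injective (punchOut-injective (v≢φ i) (v≢φ j) eq))
  (<⇒notInjective ≤-refl)
  where
  v≢φ : ∀ i → v ≢ φ i
  v≢φ i v≡φi = v∉φ (i , sym v≡φi)

T⇒true : ∀ {b} → T b → b ≡ true
T⇒true = Equivalence.to T-≡

true⇒T : ∀ {b} → b ≡ true → T b
true⇒T = Equivalence.from T-≡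

module _ {H : Graph n} where

  clique⇒copy : Clique H full r → Setoid.Carrier (Copies H (K r))
  clique⇒copy {r} Q = S , record
    { φ           = vertex Q
    ; φ-injective = vertex-injective Q
    ; φ-image     = λ v → mk⇔
        (Equivalence.to (inImage⇔ (vertex Q) v) ∘ ∈V⇒inImage)
        (inImage⇒∈V ∘ Equivalence.from (inImage⇔ (vertex Q) v))
    ; φ-adj       = φ-adj
    }
    where
    A : Fin n → Bool
    A = inImage (vertex Q)

    ∈V⇒inImage : ∀ {v} → v ∈ tabulate A → A v ≡ true
    ∈V⇒inImage {v} v∈V = trans (sym (lookup∘tabulate A v)) ([]=⇒lookup v∈V)

    inImage⇒∈V : ∀ {v} → A v ≡ true → v ∈ tabulate A
    inImage⇒∈V {v} Av = lookup⇒[]= v _ (trans (lookup∘tabulate A v) Av)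

    edge : Fin n → Fin n → Bool
    -- `adj (K n)` acts as the Boolean test that u and v are distinct.
    edge u v = (A u ∧ A v) ∧ adj (K n) u v

    edge-elim : ∀ u v → T (edge u v) → A u ≡ true × A v ≡ true × adj (K n) u v ≡ true
    edge-elim u v uv with ∧-true {A u ∧ A v} (T⇒true uv)
    ... | AuAv , u≢v with ∧-true {A u} AuAv
    ...   | Au , Av = Au , Av , u≢v

    edge⊆H : ∀ u v → T (edge u v) → T (adj H u v)
    edge⊆H u v uv with edge-elim u v uv
    ... | Au , Av , u≢v with Equivalence.to (inImage⇔ (vertex Q) u) Au
                           | Equivalence.to (inImage⇔ (vertex Q) v) Av
    ...   | i , refl | j , refl = true⇒T (adjacent Q λ { refl →
            contradiction (trans (sym u≢v) (adj-irrefl (K n) u)) λ () })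

    S : Subgraph H
    S = record
      { V     = tabulate A
      ; E     = edge
      ; E-sym = λ u v → cong₂ _∧_ (∧-comm (A u) (A v)) (adj-sym (K n) u v)
      ; E⊆H   = edge⊆H
      ; E⊆V   = λ u v uv → let Au , Av , _ = edge-elim u v uv in inImage⇒∈V Au , inImage⇒∈V Av
      }

    φ-adj : ∀ i j → edge (vertex Q i) (vertex Q j) ≡ adj (K r) i j
    φ-adj i j rewrite ∈-image (vertex Q) i | ∈-image (vertex Q) j with i ≟ j
    ... | yes refl = adj-irrefl (K n) (vertex Q i)
    ... | no  i≢j  = K-adj (i≢j ∘ vertex-injective Q)

  copy⇒clique : {S : Subgraph H} → S ≅ K r → Clique H full r
  copy⇒clique {r} {S} iso = record
    { vertex   = φ
    ; inside   = λ _ → refl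
    ; adjacent = λ {i} {j} i≢j →
        T⇒true (E⊆H S (φ i) (φ j) (true⇒T (trans (φ-adj i j) (K-adj i≢j))))
    }
    where open _≅_ iso

  -- A copy of a complete graph is determined by its vertex set, so comparing copies reduces to
  -- comparing those sets.
  copy-edge⇔ : {S : Subgraph H} → S ≅ K r → ∀ u v →
               E S u v ≡ true ⇔ (u ∈ V S × v ∈ V S × u ≢ v)
  copy-edge⇔ {r} {S} iso u v = mk⇔ to from
    where
    open _≅_ iso
    to : E S u v ≡ true → u ∈ V S × v ∈ V S × u ≢ v
    to uv = proj₁ (E⊆V S u v (true⇒T uv)) , proj₂ (E⊆V S u v (true⇒T uv)) , λ { refl →
      contradiction (trans (sym (T⇒true (E⊆H S u u (true⇒T uv)))) (adj-irrefl H u)) λ () }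

    from : u ∈ V S × v ∈ V S × u ≢ v → E S u v ≡ true
    from (u∈V , v∈V , u≢v) with Equivalence.to (φ-image u) u∈V | Equivalence.to (φ-image v) v∈V
    ... | i , refl | j , refl = trans (φ-adj i j) (K-adj (u≢v ∘ cong φ))

  copies-≈ : (X Y : Setoid.Carrier (Copies H (K r))) → V (proj₁ X) ≡ V (proj₁ Y) →
             Setoid._≈_ (Copies H (K r)) X Y
  copies-≈ (S , S≅K) (S′ , S′≅K) V≡V′ = V≡V′ , λ u v → ⇔→≡ (mk⇔
    (λ uv → Equivalence.from (copy-edge⇔ S′≅K u v)
      (subst (λ V → u ∈ V × v ∈ V × u ≢ v) V≡V′ (Equivalence.to (copy-edge⇔ S≅K u v) uv)))
    (λ uv → Equivalence.from (copy-edge⇔ S≅K u v)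
      (subst (λ V → u ∈ V × v ∈ V × u ≢ v) (sym V≡V′) (Equivalence.to (copy-edge⇔ S′≅K u v) uv))))

  𝒩≡1⇒clique : 𝒩[ H , K r ]≡ 1 → Clique H full r
  𝒩≡1⇒clique only = copy⇒clique (proj₂ (Inverse.to only zero))

  -- The copies spanned by both cliques equal the one indexed by `zero`, so their vertex sets agree.
  𝒩≡1⇒unique : 𝒩[ H , K r ]≡ 1 → (Q Q′ : Clique H full r) → ∀ i → ∃ λ j → vertex Q′ j ≡ vertex Q i
  𝒩≡1⇒unique {r} only Q Q′ i =
    Equivalence.to (_≅_.φ-image (proj₂ X′) (vertex Q i))
      (subst (vertex Q i ∈_) (proj₁ X≈X′)
        (Equivalence.from (_≅_.φ-image (proj₂ X) (vertex Q i)) (i , refl)))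
    where
    open Setoid (Copies H (K r)) using (_≈_) renaming (sym to ≈-sym; trans to ≈-trans)
    X X′ : Setoid.Carrier (Copies H (K r))
    X  = clique⇒copy Q
    X′ = clique⇒copy Q′

    ≈to-zero : ∀ Y → Inverse.to only zero ≈ Y
    ≈to-zero Y with Inverse.from only Y | Inverse.strictlyInverseˡ only Y
    ... | zero | eq = eq

    X≈X′ : X ≈ X′
    X≈X′ = ≈-trans {X} {Inverse.to only zero} {X′}
      (≈-sym {Inverse.to only zero} {X} (≈to-zero X)) (≈to-zero X′)

  -- Only images are compared, because a clique here is an ordered list and each copy has many
  -- orderings.
  unique⇒𝒩≡1 : (Q : Clique H full r) →
    ((Q′ : Clique H full r) → ∀ v → inImage (vertex Q′) v ≡ inImage (vertex Q) v) →
    𝒩[ H , K r ]≡ 1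
  unique⇒𝒩≡1 {r} Q unique = record
    { to        = const (clique⇒copy Q)
    ; from      = const zero
    ; to-cong   = λ _ → Setoid.refl (Copies H (K r)) {clique⇒copy Q}
    ; from-cong = λ _ → refl
    ; inverse   = (λ {X} _ → copies-≈ (clique⇒copy Q) X (V≡ X)) , λ { {zero} _ → refl }
    }
    where
    V≡ : ∀ X → V (proj₁ (clique⇒copy Q)) ≡ V (proj₁ X)
    V≡ (S , S≅K) = ⊆-antisym
      (λ {v} v∈Q → Equivalence.from (_≅_.φ-image S≅K v) (Equivalence.to (inImage⇔ _ v)
        (trans (unique (copy⇒clique S≅K) v) (Equivalence.from (inImage⇔ (vertex Q) v)
          (Equivalence.to (_≅_.φ-image (proj₂ (clique⇒copy Q)) v) v∈Q)))))
      (λ {v} v∈S → Equivalence.from (_≅_.φ-image (proj₂ (clique⇒copy Q)) v)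
        (Equivalence.to (inImage⇔ (vertex Q) v) (trans (sym (unique (copy⇒clique S≅K) v))
          (Equivalence.from (inImage⇔ _ v) (Equivalence.to (_≅_.φ-image S≅K v) v∈S)))))

-- Turán numbers of complete graphs

Free⇒no-clique : {G : Graph n} → K r Free G → ¬ Clique G full r
Free⇒no-clique free Q = free (clique⇒copy Q)

-- Two of the `2 + s` clique vertices would share one of the `suc s` colours.
partite-Free : (P : Partite s m t) → K (2 + s) Free graph P
partite-Free P (S , S≅K) =
  let Q = copy⇒clique S≅K
      i , j , i<j , same = pigeonhole ≤-refl (colour P ∘ vertex Q)
  in proper P _ _ (adjacent Q (<⇒≢ i<j)) same

Free⇒edgeCount≤ : CliqueFreeBound s m t → (G : Graph m) → K (2 + s) Free G → edgeCount G ≤ t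
Free⇒edgeCount≤ bound G free = *-cancelˡ-≤ 2
  (≤-trans (≤-reflexive (sym (pairs-full G))) (bound G full size-full (Free⇒no-clique free)))

-- The extremal graph with a unique K_r

module _ (P : Partite s m t) where

  link : Fin (2 + s) → Fin m → Bool
  link zero    v = false
  link (suc b) v = not (does (colour P v ≟ b))

  oneClique : Graph (2 + s + m)
  oneClique = glue (K (2 + s)) (graph P) link

  edgeCount-oneClique : edgeCount oneClique ≡ (2 + s) C 2 + s * m + t
  edgeCount-oneClique = trans (edgeCount-glue (K (2 + s)) (graph P) link)
    (cong₂ _+_ (cong₂ _+_ (edgeCount-K (suc s)) cross) (attained P))
    where
    cross : (sum λ v → sum λ a → ind (link a v)) ≡ s * m
    -- For each v, `link zero v` adds 0, and exactly one of the s + 1 values `link (suc b) v` is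
    -- false.
    cross = trans (sum-cong-≗ λ v → sum-≢ (colour P v)) (trans (sum-const m s) (*-comm m s))

  private
    Adj : Fin (2 + s) ⊎ Fin m → Fin (2 + s) ⊎ Fin m → Set
    Adj x y = glueAdj (K (2 + s)) (graph P) link x y ≡ true

    split : Fin (2 + s + m) → Fin (2 + s) ⊎ Fin m
    split = splitAt (2 + s)

    -- The value at inj₁ zero is arbitrary.
    colour⁺ : Fin (2 + s) ⊎ Fin m → Fin (suc s)
    colour⁺ (inj₁ zero)    = zero
    colour⁺ (inj₁ (suc b)) = b
    colour⁺ (inj₂ v)       = colour P v

    -- The clique vertex `suc b` can take colour b because it is joined to no vertex of that class.
    proper⁺ : ∀ x y → x ≢ inj₁ zero → y ≢ inj₁ zero → Adj x y → colour⁺ x ≢ colour⁺ y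
    proper⁺ (inj₁ zero)    y              x≢0 _   _  _    = x≢0 refl
    proper⁺ (inj₁ (suc a)) (inj₁ zero)    _   y≢0 _  _    = y≢0 refl
    proper⁺ (inj₁ (suc a)) (inj₁ (suc b)) _   _   xy refl =
      contradiction (trans (sym xy) (adj-irrefl (K (2 + s)) (suc a))) λ ()
    proper⁺ (inj₁ (suc a)) (inj₂ w)       _   _   xy refl =
      contradiction (trans (sym xy) (cong not (dec-true (colour P w ≟ a) refl))) λ ()
    proper⁺ (inj₂ v)       (inj₁ zero)    _   y≢0 _  _    = y≢0 refl
    proper⁺ (inj₂ v)       (inj₁ (suc b)) _   _   xy refl =
      contradiction (trans (sym xy) (cong not (dec-true (colour P v ≟ b) refl))) λ ()
    proper⁺ (inj₂ v)       (inj₂ w)       _   _   xy same = proper P v w xy same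

    zero-neighbour : ∀ y → Adj (inj₁ zero) y → ∃ λ b → y ≡ inj₁ b
    zero-neighbour (inj₁ b) _ = b , refl
    zero-neighbour (inj₂ w) ()

  base : Clique oneClique full (2 + s)
  base = record
    { vertex   = _↑ˡ m
    ; inside   = λ _ → refl
    ; adjacent = λ {i} {j} i≢j → trans
        (cong₂ (glueAdj (K (2 + s)) (graph P) link)
          (splitAt-↑ˡ (2 + s) i m) (splitAt-↑ˡ (2 + s) j m))
        (K-adj i≢j)
    }

  module _ (Q : Clique oneClique full (2 + s)) where

    private
      φ : Fin (2 + s) → Fin (2 + s + m)
      φ = vertex Q

    -- A clique avoiding `zero` would have `2 + s` vertices properly coloured by `suc s` colours.
    through-zero : ∃ λ i → φ i ≡ zero
    through-zero with any? (λ i → φ i ≟ zero)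
    ... | yes 0∈φ = 0∈φ
    ... | no  0∉φ =
      let i , j , i<j , same = pigeonhole ≤-refl (colour⁺ ∘ split ∘ φ)
      in contradiction same
           (proper⁺ (split (φ i)) (split (φ j)) (not-zero i) (not-zero j) (adjacent Q (<⇒≢ i<j)))
      where
      not-zero : ∀ i → split (φ i) ≢ inj₁ zero
      not-zero i eq = 0∉φ (i , sym (splitAt⁻¹-↑ˡ eq))

    -- Every other clique vertex is a neighbour of `zero`, and all neighbours of `zero` lie in the
    -- base.
    in-base : ∀ j → ∃ λ b → b ↑ˡ m ≡ φ j
    in-base j with through-zero
    ... | i , φi≡0 with i ≟ j
    ...   | yes refl = zero , sym φi≡0
    ...   | no  i≢j  =
      let b , eq = zero-neighbour (split (φ j))
            (subst (λ x → Adj (split x) (split (φ j))) φi≡0 (adjacent Q i≢j))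
      in b , splitAt⁻¹-↑ˡ eq

    -- The clique injects into the base, which has equally many vertices.
    base-in : ∀ b → ∃ λ j → φ j ≡ b ↑ˡ m
    base-in b =
      let j , eq = injective⇒surjective ψ-injective b
      in j , trans (sym (proj₂ (in-base j))) (cong (_↑ˡ m) eq)
      where
      ψ : Fin (2 + s) → Fin (2 + s)
      ψ j = proj₁ (in-base j)

      ψ-injective : Injective _≡_ _≡_ ψ
      ψ-injective {i} {j} eq = vertex-injective Q
        (trans (sym (proj₂ (in-base i))) (trans (cong (_↑ˡ m) eq) (proj₂ (in-base j))))

    same-image : ∀ v → inImage φ v ≡ inImage (vertex base) v
    same-image v = ⇔→≡ (mk⇔
      (λ Av → Equivalence.from (inImage⇔ (vertex base) v)
        (let j , φj≡v = Equivalence.to (inImage⇔ φ v) Av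
             b , b≡φj = in-base j
         in b , trans b≡φj φj≡v))
      (λ Bv → Equivalence.from (inImage⇔ φ v)
        (let b , b≡v = Equivalence.to (inImage⇔ (vertex base) v) Bv
             j , φj≡b = base-in b
         in j , trans φj≡b b≡v)))

  oneClique-𝒩 : 𝒩[ oneClique , K (2 + s) ]≡ 1
  oneClique-𝒩 = unique⇒𝒩≡1 base same-image

-- The upper bound for graphs with a unique K_r

-- The vertex at position b is replaced by w. For w outside the only clique, the result contradicts
-- uniqueness.
exchange : {G : Graph n} (Q : Clique G full r) (w : Fin n) (b : Fin r) →
           (∀ i → i ≢ b → adj G w (vertex Q i) ≡ true) →
           Σ[ Q′ ∈ Clique G full r ] vertex Q′ b ≡ w
exchange {n} {r} {G} Q w b w-adj = record
  { vertex   = φ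
  ; inside   = λ _ → refl
  ; adjacent = λ {i} {j} → φ-adj i j
  } , φ-b
  where
  φ : Fin r → Fin n
  φ i with i ≟ b
  ... | yes _ = w
  ... | no  _ = vertex Q i

  φ-b : φ b ≡ w
  φ-b with b ≟ b
  ... | yes _  = refl
  ... | no b≢b = contradiction refl b≢b

  φ-adj : ∀ i j → i ≢ j → adj G (φ i) (φ j) ≡ true
  φ-adj i j i≢j with i ≟ b | j ≟ b
  ... | yes refl | yes refl = contradiction refl i≢j
  ... | yes _    | no  j≢b  = w-adj j j≢b
  ... | no  i≢b  | yes _    = trans (adj-sym G (vertex Q i) w) (w-adj i i≢b)
  ... | no  _    | no  _    = adjacent Q i≢j

module _ (bound : CliqueFreeBound s m t) (H : Graph (2 + s + m)) (only : 𝒩[ H , K (2 + s) ]≡ 1) where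

  private
    Q : Clique H full (2 + s)
    Q = 𝒩≡1⇒clique only

    φ : Fin (2 + s) → Fin (2 + s + m)
    φ = vertex Q

    A W : Fin (2 + s + m) → Bool
    A = inImage φ
    W = not ∘ A

    full≡A+W : ∀ v → 1 ≡ ind (A v) + ind (W v)
    full≡A+W v with A v
    ... | true  = refl
    ... | false = refl

    size-W : size W ≡ m
    size-W = +-cancelˡ-≡ (2 + s) _ _ (trans
      (cong (_+ size W) (sym (size-image φ (vertex-injective Q))))
      (trans (sym (size-⊎ {W = full} A W full≡A+W)) size-full))

    -- Uniqueness puts every vertex of every such clique into `A`.
    W∌clique : ∀ {w} → W w ≡ true → (Q′ : Clique H full (2 + s)) → ∀ i → vertex Q′ i ≢ w
    W∌clique {w} Ww Q′ i refl = contradiction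
      (trans (sym Ww) (cong not (Equivalence.from (inImage⇔ φ w) (𝒩≡1⇒unique only Q′ Q i)))) λ ()

    deg-A : ∀ u → deg H A u ≡ sum λ i → ind (adj H u (φ i))
    deg-A u = sum-image φ (vertex-injective Q) (λ v → ind (adj H u v))

    pairs-AA : pairs H A A ≡ (2 + s) * suc s
    pairs-AA = begin
      pairs H A A
        ≡⟨ sum-image φ (vertex-injective Q) (deg H A) ⟩
      (sum λ i → deg H A (φ i))
        ≡⟨ sum-cong-≗ (λ i → trans (deg-A (φ i)) (sum-cong-≗ λ j → cong ind (φ-adj i j))) ⟩
      (sum λ i → sum λ j → ind (adj (K (2 + s)) i j))
        ≡⟨ ∑adj-K (suc s) ⟩
      (2 + s) * suc s ∎
      where
      open ≡-Reasoning
      φ-adj : ∀ i j → adj H (φ i) (φ j) ≡ adj (K (2 + s)) i j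
      φ-adj i j with i ≟ j
      ... | yes refl = adj-irrefl H (φ i)
      ... | no  i≢j  = adjacent Q i≢j

    deg-A≤s : ∀ w → W w ≡ true → deg H A w ≤ s
    deg-A≤s w Ww with all-but-one⊎deficient (λ i → adj H w (φ i))
    ... | inj₂ (s≤s few)   = ≤-trans (≤-reflexive (deg-A w)) few
    ... | inj₁ (b , w-adj) =
      let Q′ , Q′b≡w = exchange Q w b w-adj in contradiction Q′b≡w (W∌clique Ww Q′ b)

    W-no-clique : ¬ Clique H W (2 + s)
    W-no-clique R = W∌clique (inside R zero)
      (record { vertex = vertex R ; inside = λ _ → refl ; adjacent = adjacent R }) zero refl

  -- The three terms bound the edges inside `A`, those between `A` and `W`, and those inside `W`.
  edgeCount≤ : edgeCount H ≤ (2 + s) C 2 + s * m + t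
  edgeCount≤ = *-cancelˡ-≤ 2 (begin
    2 * edgeCount H
      ≡⟨ pairs-full H ⟨
    pairs H full full
      ≡⟨ pairs-⊎ A W full≡A+W H ⟩
    pairs H A A + (2 * pairs H W A + pairs H W W)
      ≤⟨ +-mono-≤ (≤-reflexive pairs-AA) (+-mono-≤
           (*-monoʳ-≤ 2 (pairs≤size*d H W A s deg-A≤s))
           (bound H W size-W W-no-clique)) ⟩
    (2 + s) * suc s + (2 * (size W * s) + 2 * t)
      ≡⟨ cong₂ (λ x y → x + (2 * (y * s) + 2 * t)) (sym (2*[1+r]C2 (suc s))) size-W ⟩
    2 * ((2 + s) C 2) + (2 * (m * s) + 2 * t)
      ≡⟨ regroup ((2 + s) C 2) m s t ⟩
    2 * ((2 + s) C 2 + s * m + t) ∎)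
    where
    open ≤-Reasoning
    regroup : ∀ c m s t → 2 * c + (2 * (m * s) + 2 * t) ≡ 2 * (c + s * m + t)
    regroup = solve-∀

-- Both bounds combined

theorem1p4 : ∀ (r n : ℕ) → 2 ≤ r → r ≤ n →
    ∃ λ (e : ℕ) → ∃ λ (t : ℕ) →
    (exa[ 1 , n , K r ]≡ e) ×
    (ex[ n ∸ r , K r ]≡ t) ×
    (e ≡ (r C 2) + (r ∸ 2) * (n ∸ r) + t)
theorem1p4 r@(suc (suc s)) n (s≤s (s≤s z≤n)) r≤n with m≤n⇒∃[o]m+o≡n r≤n
... | m , refl rewrite m+n∸m≡n r m =
  -- One application of Turán's theorem serves both extremal numbers: `P` gives the constructions,
  -- and `bound` the upper bounds.
  let t , P , bound = turán s m in
  (r C 2) + s * m + t , t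
  , ( (oneClique P , oneClique-𝒩 P , edgeCount-oneClique P)
    , λ { _ (H , only , refl) → edgeCount≤ bound H only })
  , ( (graph P , partite-Free P , attained P)
    , λ { _ (G , free , refl) → Free⇒edgeCount≤ bound G free })
  , refl
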